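{- If an infinite tournament $G=(V,E)$ is not in $\mathfrak{Out}_2$, then $G\in\mathfrak{In}_1\text{ - }\mathfrak{Out}_1$.
   Context: A tournament is a digraph $G=(V,E)$ such that for any two distinct $x,y\in V$ exactly one of $(x,y),(y,x)$ is in $E$. For $W\subseteq V$, $G[W]=(W,E\cap (W\times W))$ is the induced subgraph. A set $A\subseteq V$ is independent if there is no edge (in either direction) between two distinct elements of $A$. For $n\in\mathbb N$ and $A\subseteq V$, $\mathrm{Out}^G_n(A)$ (resp. $\mathrm{In}^G_n(A)$) is the set of all $v\in V$ such that there is a directed path of length at most $n$ from some point of $A$ to $v$ (resp. from $v$ to some point of $A$); length $0$ is allowed. $G\in\mathfrak{Out}_n$ (resp. $G\in\mathfrak{In}_n$) iff there is an independent $A\subseteq V$ with $V=\mathrm{Out}^G_n(A)$ (resp. $V=\mathrm{In}^G_n(A)$). $G\in\mathfrak{In}_n\text{ - }\mathfrak{Out}_k$ iff there is a partition $(V_1,V_2)$ of $V$ (parts may be empty) with $G[V_1]\in\mathfrak{In}_n$ and $G[V_2]\in\mathfrak{Out}_k$. -}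

module Defs where

open import Level using (Level; suc)
open import Data.Nat.Base as ℕ using (ℕ; _≤_)
open import Data.Fin.Base using (Fin; zero; inject₁; fromℕ) renaming (suc to fsuc)
open import Data.Product.Base using (∃-syntax; _×_)
open import Data.Refinement using (Refinement-syntax; value)
open import Data.Sum.Base using (_⊎_)
open import Function.Bundles using (_⤖_)
open import Function.Definitions using (Injective)
open import Relation.Binary.Core using (Rel)
open import Relation.Binary.PropositionalEquality.Core using (_≡_; _≢_)
open import Relation.Nullary.Negation.Core using (¬_)
open import Relation.Unary using (Pred; _∈_; _∪_; _⊥_; Universal)

private
  variable
    ℓ : Level

-- Loops are neither required nor excluded.
record Digraph (ℓ : Level) : Set (suc ℓ) where
  field
    V : Set ℓ
    E : Rel V ℓ

open Digraph public

Infinite : Set ℓ → Set ℓ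
Infinite A = ¬ (∃[ n ] (Fin n ⤖ A))

IsTournament : Digraph ℓ → Set ℓ
IsTournament G = ∀ x y → x ≢ y →
  (E G x y × ¬ E G y x) ⊎ (¬ E G x y × E G y x)

-- A refinement type carries an irrelevant membership proof, so each element
-- of W gives exactly one vertex even when W is not proposition-valued.
_[_] : (G : Digraph ℓ) → Pred (V G) ℓ → Digraph ℓ
V (G [ W ]) = [ v ∈ V G ∣ W v ]
E (G [ W ]) x y = E G (value x) (value y)

Independent : (G : Digraph ℓ) → Pred (V G) ℓ → Set ℓ
Independent G A = ∀ x y → x ∈ A → y ∈ A → x ≢ y → ¬ (E G x y ⊎ E G y x)

-- A directed path with k edges visits k + 1 pairwise distinct vertices.
record DirectedPath (G : Digraph ℓ) (k : ℕ) (x y : V G) : Set ℓ where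
  field
    vertex   : Fin (ℕ.suc k) → V G
    distinct : Injective _≡_ _≡_ vertex
    edge     : ∀ (i : Fin k) → E G (vertex (inject₁ i)) (vertex (fsuc i))
    start    : vertex zero ≡ x
    end      : vertex (fromℕ k) ≡ y

Out : (G : Digraph ℓ) → ℕ → Pred (V G) ℓ → Pred (V G) ℓ
Out G n A v = ∃[ a ] (a ∈ A × ∃[ k ] (k ≤ n × DirectedPath G k a v))

In : (G : Digraph ℓ) → ℕ → Pred (V G) ℓ → Pred (V G) ℓ
In G n A v = ∃[ a ] (a ∈ A × ∃[ k ] (k ≤ n × DirectedPath G k v a))

𝔒𝔲𝔱 : ℕ → Pred (Digraph ℓ) (suc ℓ)
𝔒𝔲𝔱 n G = ∃[ A ] (Independent G A × Universal (Out G n A))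

ℑ𝔫 : ℕ → Pred (Digraph ℓ) (suc ℓ)
ℑ𝔫 n G = ∃[ A ] (Independent G A × Universal (In G n A))

ℑ𝔫-𝔒𝔲𝔱 : ℕ → ℕ → Pred (Digraph ℓ) (suc ℓ)
ℑ𝔫-𝔒𝔲𝔱 n k G = ∃[ V₁ ] ∃[ V₂ ]
  (Universal (V₁ ∪ V₂) × V₁ ⊥ V₂ × G [ V₁ ] ∈ ℑ𝔫 n × G [ V₂ ] ∈ 𝔒𝔲𝔱 k)

{-# OPTIONS --safe #-}
-- No vertex x of G reaches everything in two steps, so some y ≠ x is out of
-- reach: x ↛ y, and no out-neighbour of x points to y. Hence y dominates all
-- out-neighbours of x, and every other vertex is x itself or points to x.
module Submission where

open import Defs
open import Level using (Level)
open import Axiom.ExcludedMiddle using (ExcludedMiddle)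
open import Axiom.DoubleNegationElimination using (em⇒dne)
open import Data.Empty using (⊥-elim)
open import Data.Fin.Base using (zero; suc)
open import Data.Irrelevant using () renaming ([_] to irr)
open import Data.Nat.Base using (z≤n; s≤s)
open import Data.Product.Base using (_×_; _,_; proj₁; proj₂; ∃-syntax)
open import Data.Refinement using (value; _,_)
open import Data.Refinement.Properties using (value-injective)
open import Data.Sum.Base using (_⊎_; inj₁; inj₂; swap)
open import Function.Base using (_∘_)
open import Function.Bundles using (mk⤖)
open import Relation.Binary.PropositionalEquality using (_≡_; _≢_; refl; sym; subst)
open import Relation.Nullary using (¬_; yes; no; recompute)
open import Relation.Nullary.Decidable using (toSum)
open import Relation.Unary using (Pred; _∈_; _∉_; ∁; Universal; ｛_｝)

private
  variable
    ℓ : Level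

module _ (G : Digraph ℓ) where

  private
    variable
      p q r : V G

  trivialPath : DirectedPath G 0 p p
  trivialPath {p = p} = record
    { vertex   = λ _ → p
    ; distinct = λ { {zero} {zero} _ → refl }
    ; edge     = λ ()
    ; start    = refl
    ; end      = refl
    }

  edgePath : p ≢ q → E G p q → DirectedPath G 1 p q
  edgePath {p = p} {q = q} p≢q pq = record
    { vertex   = λ { zero → p ; (suc _) → q }
    ; distinct = λ { {zero}     {zero}     _  → refl
                   ; {zero}     {suc zero} eq → ⊥-elim (p≢q eq)
                   ; {suc zero} {zero}     eq → ⊥-elim (p≢q (sym eq))
                   ; {suc zero} {suc zero} _  → refl
                   }
    ; edge     = λ { zero → pq }
    ; start    = refl
    ; end      = refl
    }

  twoEdgePath : p ≢ q → q ≢ r → p ≢ r → E G p q → E G q r → DirectedPath G 2 p r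
  twoEdgePath {p = p} {q = q} {r = r} p≢q q≢r p≢r pq qr = record
    { vertex   = λ { zero → p ; (suc zero) → q ; (suc (suc _)) → r }
    ; distinct = λ { {zero}           {zero}           _  → refl
                   ; {zero}           {suc zero}       eq → ⊥-elim (p≢q eq)
                   ; {zero}           {suc (suc zero)} eq → ⊥-elim (p≢r eq)
                   ; {suc zero}       {zero}           eq → ⊥-elim (p≢q (sym eq))
                   ; {suc zero}       {suc zero}       _  → refl
                   ; {suc zero}       {suc (suc zero)} eq → ⊥-elim (q≢r eq)
                   ; {suc (suc zero)} {zero}           eq → ⊥-elim (p≢r (sym eq))
                   ; {suc (suc zero)} {suc zero}       eq → ⊥-elim (q≢r (sym eq))
                   ; {suc (suc zero)} {suc (suc zero)} _  → refl
                   }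
    ; edge     = λ { zero → pq ; (suc zero) → qr }
    ; start    = refl
    ; end      = refl
    }

  singleton-independent : (a : V G) → Independent G ｛ a ｝
  singleton-independent a x y refl refl x≢x _ = x≢x refl

-- If `A` were empty, the empty function would be a bijection from `Fin 0`. This supplies the first
-- vertex of the construction.
infinite⇒inhabited : {A : Set ℓ} → ExcludedMiddle ℓ → Infinite A → A
infinite⇒inhabited em inf = em⇒dne em λ ¬a →
  inf (0 , mk⤖ {to = λ ()} ((λ {}) , ⊥-elim ∘ ¬a))

module _ (em : ExcludedMiddle ℓ) (G : Digraph ℓ) where

  -- A singleton is independent, and the path of length 0 takes care of `a` itself, so no loop at
  -- `a` is asked for.
  source⇒𝔒𝔲𝔱₁ : (a : V G) → (∀ v → v ≢ a → E G a v) → G ∈ 𝔒𝔲𝔱 1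
  source⇒𝔒𝔲𝔱₁ a av = ｛ a ｝ , singleton-independent G a , reach
    where
    reach : Universal (Out G 1 ｛ a ｝)
    reach v with em {v ≡ a}
    ... | yes refl = a , refl , 0 , z≤n , trivialPath G
    ... | no v≢a   = a , refl , 1 , s≤s z≤n , edgePath G (v≢a ∘ sym) (av v v≢a)

  sink⇒ℑ𝔫₁ : (a : V G) → (∀ v → v ≢ a → E G v a) → G ∈ ℑ𝔫 1
  sink⇒ℑ𝔫₁ a va = ｛ a ｝ , singleton-independent G a , reach
    where
    reach : Universal (In G 1 ｛ a ｝)
    reach v with em {v ≡ a}
    ... | yes refl = a , refl , 0 , z≤n , trivialPath G
    ... | no v≢a   = a , refl , 1 , s≤s z≤n , edgePath G v≢a (va v v≢a)

  -- Otherwise the independent set `｛ x ｝` alone would witness membership in `𝔒𝔲𝔱 n`.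
  unreached : ∀ {n} → G ∉ 𝔒𝔲𝔱 n → ∀ x → ∃[ y ] (y ∉ Out G n ｛ x ｝)
  unreached G∉Out x = em⇒dne em λ all-reached →
    G∉Out (｛ x ｝ , singleton-independent G x ,
           λ y → em⇒dne em λ y∉ → all-reached (y , y∉))

theorem3p1 : (ℓ : Level) → ExcludedMiddle ℓ → (G : Digraph ℓ) → IsTournament G → Infinite (V G) → G ∉ 𝔒𝔲𝔱 2 → G ∈ ℑ𝔫-𝔒𝔲𝔱 1 1
theorem3p1 ℓ em G tournament infinite G∉𝔒𝔲𝔱₂ =
  ∁ V₂ , V₂ , cover , (λ (v∉V₂ , v∈V₂) → v∉V₂ v∈V₂) ,
  sink⇒ℑ𝔫₁ em (G [ ∁ V₂ ]) (x , irr x∉V₂) into-x ,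
  source⇒𝔒𝔲𝔱₁ em (G [ V₂ ]) (y , irr (inj₁ refl)) from-y
  where
  x : V G
  x = infinite⇒inhabited em infinite

  y : V G
  y = proj₁ (unreached em G G∉𝔒𝔲𝔱₂ x)

  y∉Out₂ : y ∉ Out G 2 ｛ x ｝
  y∉Out₂ = proj₂ (unreached em G G∉𝔒𝔲𝔱₂ x)

  x≢y : x ≢ y
  x≢y x≡y = y∉Out₂ (x , refl , 0 , z≤n , subst (DirectedPath G 0 x) x≡y (trivialPath G))

  -- The out-neighbours of `x`, together with the vertex `y` that is to be their source. Since loops
  -- are allowed, `x ≢ v` keeps `x` itself outside, where it is to be the sink of the complement.
  V₂ : Pred (V G) ℓ
  V₂ v = v ≡ y ⊎ (x ≢ v × E G x v)

  x∉V₂ : x ∉ V₂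
  x∉V₂ (inj₁ x≡y)       = x≢y x≡y
  x∉V₂ (inj₂ (x≢x , _)) = x≢x refl

  cover : ∀ v → v ∉ V₂ ⊎ v ∈ V₂
  cover v = swap (toSum em)

  -- A vertex outside `V₂` is not an out-neighbour of `x`, so the tournament orients its edge
  -- towards `x`.
  into-x : ∀ v → v ≢ (x , irr x∉V₂) → E G (value v) x
  into-x (v , irr v∉V₂) v≢x with tournament v x (v≢x ∘ value-injective)
  ... | inj₁ (vx , _) = vx
  -- Vertices of an induced subgraph carry only an irrelevant membership proof; excluded middle
  -- decides the proposition, which lets `recompute` turn it into a usable one.
  ... | inj₂ (_ , xv) = ⊥-elim (recompute em v∉V₂ (inj₂ (v≢x ∘ value-injective ∘ sym , xv)))

  from-y : ∀ v → v ≢ (y , irr (inj₁ refl)) → E G y (value v)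
  from-y (v , irr v∈V₂) v≢y with recompute em v∈V₂
  ... | inj₁ v≡y = ⊥-elim (v≢y (value-injective v≡y))
  ... | inj₂ (x≢v , xv) with tournament y v (v≢y ∘ value-injective ∘ sym)
  ...   | inj₁ (yv , _) = yv
  -- An edge from `v` to `y` would complete the path `x`, `v`, `y` of length 2 with distinct
  -- vertices, against the choice of `y`.
  ...   | inj₂ (_ , vy) = ⊥-elim (y∉Out₂
            (x , refl , 2 , s≤s (s≤s z≤n) ,
             twoEdgePath G x≢v (v≢y ∘ value-injective) x≢y xv vy))
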